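{- Let $G$ be a finite simple graph that is $\{2K_2, K_5-e\}$-free with $\omega(G)\geq 4$. Then $\chi(G)\leq 6$ if $\omega(G)=4$, and $\chi(G)\leq \omega(G)$ if $\omega(G)\geq 5$.
   Context: $\chi(G)$ is the chromatic number and $\omega(G)$ the clique number of $G$. $2K_2$ is the disjoint union of two edges; $K_5-e$ is the complete graph on five vertices with one edge removed. A graph is $\mathcal{F}$-free if it has no induced subgraph isomorphic to a member of $\mathcal{F}$. -}

module Defs where

open import Data.Nat using (ℕ; zero; suc; _≤_)
open import Data.Nat.Base using (_≡ᵇ_)
open import Data.Fin using (Fin; toℕ)
open import Data.Fin.Properties using (all?)
open import Data.Bool using (Bool; true; false; _∧_; _∨_; not)
open import Data.Bool.Properties using () renaming (_≟_ to _≟ᵇ_)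
open import Data.Product using (Σ; _×_)
open import Data.Unit using (tt)
open import Function.Definitions using (Injective)
open import Relation.Nullary using (¬_)
open import Relation.Nullary.Decidable using (toWitness)
open import Relation.Binary.PropositionalEquality using (_≡_; _≢_)

record Graph : Set where
  field
    n      : ℕ
    adj    : Fin n → Fin n → Bool
    sym    : ∀ u v → adj u v ≡ adj v u
    irrefl : ∀ v → adj v v ≡ false

open Graph public

Adj : (G : Graph) → Fin (n G) → Fin (n G) → Set
Adj G u v = adj G u v ≡ true

InducedSubgraph : Graph → Graph → Set
InducedSubgraph H G =
  Σ (Fin (n H) → Fin (n G)) λ f →
    Injective _≡_ _≡_ f × (∀ u v → adj H u v ≡ adj G (f u) (f v))

Free : Graph → Graph → Set
Free H G = ¬ InducedSubgraph H G

HasClique : Graph → ℕ → Set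
HasClique G k =
  Σ (Fin k → Fin (n G)) λ f →
    Injective _≡_ _≡_ f × (∀ i j → i ≢ j → Adj G (f i) (f j))

CliqueNumber : Graph → ℕ → Set
CliqueNumber G k = HasClique G k × ¬ HasClique G (suc k)

Colorable : Graph → ℕ → Set
Colorable G c =
  Σ (Fin (n G) → Fin c) λ col → ∀ u v → Adj G u v → col u ≢ col v

symAdj : (m : ℕ) → (ℕ → ℕ → Bool) → Fin m → Fin m → Bool
symAdj m e u v = not (toℕ u ≡ᵇ toℕ v) ∧ (e (toℕ u) (toℕ v) ∨ e (toℕ v) (toℕ u))

e2K₂ : ℕ → ℕ → Bool
e2K₂ 0 1 = true
e2K₂ 2 3 = true
e2K₂ _ _ = false

2K₂ : Graph
2K₂ = record
  { n = 4
  ; adj = symAdj 4 e2K₂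
  ; sym = toWitness {a? = all? λ u → all? λ v → symAdj 4 e2K₂ u v ≟ᵇ symAdj 4 e2K₂ v u} tt
  ; irrefl = toWitness {a? = all? λ v → symAdj 4 e2K₂ v v ≟ᵇ false} tt
  }

eK₅-e : ℕ → ℕ → Bool
eK₅-e 0 1 = false
eK₅-e 1 0 = false
eK₅-e _ _ = true

K₅-e : Graph
K₅-e = record
  { n = 5
  ; adj = symAdj 5 eK₅-e
  ; sym = toWitness {a? = all? λ u → all? λ v → symAdj 5 eK₅-e u v ≟ᵇ symAdj 5 eK₅-e v u} tt
  ; irrefl = toWitness {a? = all? λ v → symAdj 5 eK₅-e v v ≟ᵇ false} tt
  }

{-# OPTIONS --safe #-}
-- Fix a maximum clique v₀, …, v_{k-1}.  As G is (K₅-e)-free, a vertex outside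
-- the clique has at most two neighbours in it; as G is 2K₂-free, the outside
-- vertices that miss two given clique vertices form an independent set.  Such
-- a set can share its colour with either of the two clique vertices it misses.
-- Choose pairs of clique vertices so that meeting all of them takes three clique
-- vertices: every outside vertex then misses one of the chosen pairs.  For k = 4
-- take all six pairs, whose colours also serve v₀, …, v₃.  For k ≥ 5 take the
-- edges of the triangle v₀v₁v₂ and the edge v₃v₄, which reuse the colours of
-- v₀, v₁, v₂ and v₃.
module Submission where

open import Defs
open import Data.Bool using (true)
open import Data.Bool.Properties using (¬-not) renaming (_≟_ to _≟ᵇ_)
open import Data.Fin
  using (Fin; Fin′; zero; suc; inject; compare; less; equal; greater; _↑ˡ_)
open import Data.Fin.Patterns using (0F; 1F; 2F; 3F; 4F; 5F)
open import Data.Fin.Properties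
  using (_≟_; _<?_; <-trans; <⇒≢; all?; any?; ¬∀⟶∃¬; ↑ˡ-injective)
open import Data.Nat using (ℕ; suc; _+_; _≤_; s≤s)
open import Data.Product using (∃; _×_; _,_; proj₁; proj₂)
open import Data.Sum using (_⊎_; inj₁; inj₂; [_,_]′)
open import Data.Unit using (tt)
open import Data.Vec.Functional using ([]; _∷_)
open import Function using (id; _∘_)
open import Function.Definitions using (Injective)
open import Level using (0ℓ)
open import Relation.Binary.PropositionalEquality
  using (_≡_; _≢_; refl; trans; cong; subst; module ≡-Reasoning) renaming (sym to ≡-sym)
open import Relation.Nullary using (¬_; Dec; yes; no; contradiction)
open import Relation.Nullary.Decidable
  using (True; toWitness; decidable-stable; ¬?; _→-dec_; _⊎-dec_; _×-dec_)
open import Relation.Unary using (Pred; Decidable)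

module _ (G : Graph) where

  Adj? : ∀ u v → Dec (Adj G u v)
  Adj? u v = adj G u v ≟ᵇ true

  Adj-sym : ∀ {u v} → Adj G u v → Adj G v u
  Adj-sym {u} {v} = trans (sym G v u)

  Adj-irrefl : ∀ {u v} → u ≡ v → ¬ Adj G u v
  Adj-irrefl {u} refl uu with () ← trans (≡-sym uu) (irrefl G u)

  Twins : Fin (n G) → Fin (n G) → Set
  Twins u v = ∀ w → adj G u w ≡ adj G v w

  Twins? : ∀ u v → Dec (Twins u v)
  Twins? u v = all? λ w → adj G u w ≟ᵇ adj G v w

  independent-cover⇒colorable : ∀ {m} (Class : Fin m → Pred (Fin (n G)) 0ℓ) →
    (∀ x → ∃ λ c → Class c x) →
    (∀ {c x y} → Class c x → Class c y → ¬ Adj G x y) →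
    Colorable G m
  independent-cover⇒colorable Class covers independent =
    proj₁ ∘ covers ,
    λ x y xy same → independent (subst (λ c → Class c x) same (proj₂ (covers x)))
                                (proj₂ (covers y)) xy

  pairwise-adjacent⇒clique : ∀ {k} (f : Fin k → Fin (n G)) →
    (∀ i j → i ≢ j → Adj G (f i) (f j)) → HasClique G k
  pairwise-adjacent⇒clique f adjacent = f , injective , adjacent
    where
    injective : Injective _≡_ _≡_ f
    injective {i} {j} fi≡fj =
      decidable-stable (i ≟ j) λ i≢j → Adj-irrefl fi≡fj (adjacent i j i≢j)

  dominated-clique-extends : ∀ {k} ((f , _) : HasClique G k) →
    ∀ {x} → (∀ i → Adj G x (f i)) → HasClique G (suc k)
  dominated-clique-extends (f , _ , f-adj) {x} dominates =
    pairwise-adjacent⇒clique (x ∷ f) λ where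
      zero    zero    0≢0 → contradiction refl 0≢0
      zero    (suc j) _   → dominates j
      (suc i) zero    _   → Adj-sym (dominates i)
      (suc i) (suc j) i≢j → f-adj i j (i≢j ∘ cong suc)

module _ {H G : Graph} (g : Fin (n H) → Fin (n G))
         (preserves-below : ∀ v (u : Fin′ v) →
           adj H (inject u) v ≡ adj G (g (inject u)) (g v)) where

  open ≡-Reasoning

  preserves-adj : ∀ u v → adj H u v ≡ adj G (g u) (g v)
  preserves-adj u v with compare u v
  ... | less v u    = preserves-below v u
  ... | equal u     = trans (irrefl H u) (≡-sym (irrefl G (g u)))
  ... | greater u v = begin
    adj H u (inject v)          ≡⟨ sym H u (inject v) ⟩
    adj H (inject v) u          ≡⟨ preserves-below u v ⟩
    adj G (g (inject v)) (g u)  ≡⟨ sym G (g (inject v)) (g u) ⟩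
    adj G (g u) (g (inject v))  ∎

  equal-images⇒twins : ∀ {u v} → g u ≡ g v → Twins H u v
  equal-images⇒twins {u} {v} gu≡gv w = begin
    adj H u w          ≡⟨ preserves-adj u w ⟩
    adj G (g u) (g w)  ≡⟨ cong (λ x → adj G x (g w)) gu≡gv ⟩
    adj G (g v) (g w)  ≡⟨ preserves-adj v w ⟨
    adj H v w          ∎

  twins-separated⇒induced :
    (∀ v (u : Fin′ v) → Twins H (inject u) v → g (inject u) ≢ g v) → InducedSubgraph H G
  twins-separated⇒induced separated = g , injective , preserves-adj
    where
    separated-below : ∀ v (u : Fin′ v) → g (inject u) ≢ g v
    separated-below v u eq = separated v u (equal-images⇒twins eq) eq

    injective : Injective _≡_ _≡_ g
    injective {u} {v} gu≡gv with compare u v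
    ... | less v u    = contradiction gu≡gv (separated-below v u)
    ... | equal _     = refl
    ... | greater u v = contradiction (≡-sym gu≡gv) (separated-below u v)

2K₂-twin-free : ∀ v (u : Fin′ v) → ¬ Twins 2K₂ (inject u) v
2K₂-twin-free = toWitness {a? = all? λ v → all? λ u → ¬? (Twins? 2K₂ (inject u) v)} tt

K₅-e-twins : ∀ v (u : Fin′ v) → Twins K₅-e (inject u) v → inject u ≡ 0F × v ≡ 1F
K₅-e-twins = toWitness {a? = all? λ v → all? λ u →
  Twins? K₅-e (inject u) v →-dec ((inject u ≟ 0F) ×-dec (v ≟ 1F))} tt

module _ (G : Graph) where

  anticomplete-edges⇒2K₂ : ∀ {a b c d} → Adj G a b → Adj G c d →
    ¬ Adj G a c → ¬ Adj G a d → ¬ Adj G b c → ¬ Adj G b d → InducedSubgraph 2K₂ G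
  anticomplete-edges⇒2K₂ {a} {b} {c} {d} ab cd ac ad bc bd =
    twins-separated⇒induced {2K₂} {G} g preserves-below
      λ v u twins → contradiction twins (2K₂-twin-free v u)
    where
    g : Fin 4 → Fin (n G)
    g = a ∷ b ∷ c ∷ d ∷ []

    preserves-below : ∀ v (u : Fin′ v) → adj 2K₂ (inject u) v ≡ adj G (g (inject u)) (g v)
    preserves-below 1F 0F = ≡-sym ab
    preserves-below 2F 0F = ≡-sym (¬-not ac)
    preserves-below 2F 1F = ≡-sym (¬-not bc)
    preserves-below 3F 0F = ≡-sym (¬-not ad)
    preserves-below 3F 1F = ≡-sym (¬-not bd)
    preserves-below 3F 2F = ≡-sym cd

  triangle-with-two-apexes⇒K₅-e : ∀ {x y a b c} → x ≢ y → ¬ Adj G x y →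
    Adj G x a → Adj G x b → Adj G x c → Adj G y a → Adj G y b → Adj G y c →
    Adj G a b → Adj G a c → Adj G b c → InducedSubgraph K₅-e G
  triangle-with-two-apexes⇒K₅-e {x} {y} {a} {b} {c} x≢y xy xa xb xc ya yb yc ab ac bc =
    twins-separated⇒induced {K₅-e} {G} g preserves-below separated
    where
    g : Fin 5 → Fin (n G)
    g = x ∷ y ∷ a ∷ b ∷ c ∷ []

    preserves-below : ∀ v (u : Fin′ v) → adj K₅-e (inject u) v ≡ adj G (g (inject u)) (g v)
    preserves-below 1F 0F = ≡-sym (¬-not xy)
    preserves-below 2F 0F = ≡-sym xa
    preserves-below 2F 1F = ≡-sym ya
    preserves-below 3F 0F = ≡-sym xb
    preserves-below 3F 1F = ≡-sym yb
    preserves-below 3F 2F = ≡-sym ab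
    preserves-below 4F 0F = ≡-sym xc
    preserves-below 4F 1F = ≡-sym yc
    preserves-below 4F 2F = ≡-sym ac
    preserves-below 4F 3F = ≡-sym bc

    separated : ∀ v (u : Fin′ v) → Twins K₅-e (inject u) v → g (inject u) ≢ g v
    separated v u twins with inject u | K₅-e-twins v u twins
    ... | _ | refl , refl = x≢y

_Meets_ : ∀ {k} → Pred (Fin k) 0ℓ → Fin k × Fin k → Set
S Meets (s , t) = S s ⊎ S t

meets? : ∀ {k} {S : Pred (Fin k) 0ℓ} → Decidable S → Decidable (S Meets_)
meets? S? (s , t) = S? s ⊎-dec S? t

data ThreeElements {k} (S : Pred (Fin k) 0ℓ) : Set where
  three : ∀ {a b c} {a<b : True (a <? b)} {b<c : True (b <? c)} →
          S a → S b → S c → ThreeElements S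

TransversalNumber≥3 : ∀ {q k} → (Fin q → Fin k × Fin k) → Set₁
TransversalNumber≥3 pair = ∀ {S} → (∀ p → S Meets pair p) → ThreeElements S

-- pairColour p is for outside vertices that miss both ends of pair p, so these
-- ends are the only clique vertices that may safely receive the same colour.
record PairColouring (k m : ℕ) : Set₁ where
  field
    {q}                  : ℕ
    pair                 : Fin q → Fin k × Fin k
    ends-distinct        : ∀ p → proj₁ (pair p) ≢ proj₂ (pair p)
    transversal-number≥3 : TransversalNumber≥3 pair
    vertexColour         : Fin k → Fin m
    vertexColour-inj     : Injective _≡_ _≡_ vertexColour
    pairColour           : Fin q → Fin m
    pairColour-inj       : Injective _≡_ _≡_ pairColour
    shared-colour⇒end    : ∀ p i → pairColour p ≡ vertexColour i → (i ≡_) Meets pair p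

module _ (G : Graph) {k : ℕ} (K : HasClique G k) where

  private
    f : Fin k → Fin (n G)
    f = proj₁ K

    f-adj : ∀ i j → i ≢ j → Adj G (f i) (f j)
    f-adj = proj₂ (proj₂ K)

  Outside : Pred (Fin (n G)) 0ℓ
  Outside x = ¬ ∃ λ i → f i ≡ x

  CliqueNeighbour : Fin (n G) → Pred (Fin k) 0ℓ
  CliqueNeighbour x i = Adj G x (f i)

  Misses : Fin (n G) → Fin k × Fin k → Set
  Misses x st = ¬ (CliqueNeighbour x Meets st)

  three-clique-neighbours⇒dominates : Free K₅-e G →
    ∀ {x} → Outside x → ThreeElements (CliqueNeighbour x) → ∀ i → CliqueNeighbour x i
  three-clique-neighbours⇒dominates K₅-e-free {x} out
    (three {a} {b} {c} {a<b} {b<c} xa xb xc) i = decidable-stable (Adj? G x (f i)) λ ¬xi →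
      let
        i≢ : ∀ {j} → CliqueNeighbour x j → i ≢ j
        i≢ xj i≡j = ¬xi (subst (CliqueNeighbour x) (≡-sym i≡j) xj)
      in
      K₅-e-free (triangle-with-two-apexes⇒K₅-e G (λ x≡fi → out (i , ≡-sym x≡fi)) ¬xi
        xa xb xc (f-adj i a (i≢ xa)) (f-adj i b (i≢ xb)) (f-adj i c (i≢ xc))
        (f-adj a b (<⇒≢ (toWitness a<b)))
        (f-adj a c (<⇒≢ (<-trans (toWitness a<b) (toWitness b<c))))
        (f-adj b c (<⇒≢ (toWitness b<c))))

  outside-misses-pair : ¬ HasClique G (suc k) → Free K₅-e G →
    ∀ {q} (pair : Fin q → Fin k × Fin k) →
    TransversalNumber≥3 pair → ∀ {x} → Outside x → ∃ λ p → Misses x (pair p)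
  outside-misses-pair maximum K₅-e-free pair τ≥3 {x} out =
    ¬∀⟶∃¬ _ _ (λ p → meets? (λ i → Adj? G x (f i)) (pair p)) λ transversal →
      maximum (dominated-clique-extends G K
        (three-clique-neighbours⇒dominates K₅-e-free out (τ≥3 transversal)))

  missing-pair-independent : Free 2K₂ G → ∀ {s t} → s ≢ t →
    ∀ {x y} → Misses x (s , t) → Misses y (s , t) → ¬ Adj G x y
  missing-pair-independent 2K₂-free s≢t x-misses y-misses xy =
    2K₂-free (anticomplete-edges⇒2K₂ G xy (f-adj _ _ s≢t)
      (x-misses ∘ inj₁) (x-misses ∘ inj₂) (y-misses ∘ inj₁) (y-misses ∘ inj₂))

  pair-colouring⇒colorable : ¬ HasClique G (suc k) → Free 2K₂ G → Free K₅-e G →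
    ∀ {m} → PairColouring k m → Colorable G m
  pair-colouring⇒colorable maximum 2K₂-free K₅-e-free {m} colouring =
    independent-cover⇒colorable G Class covers independent
    where
    open PairColouring colouring

    data Class (c : Fin m) (x : Fin (n G)) : Set where
      member  : ∀ i → f i ≡ x → vertexColour i ≡ c → Class c x
      outside : ∀ p → Misses x (pair p) → pairColour p ≡ c → Class c x

    covers : ∀ x → ∃ λ c → Class c x
    covers x with any? (λ i → f i ≟ x)
    ... | yes (i , fi≡x) = vertexColour i , member i fi≡x refl
    ... | no out =
      let p , misses = outside-misses-pair maximum K₅-e-free pair transversal-number≥3 out
      in  pairColour p , outside p misses refl

    shared-colour⇒nonadjacent : ∀ {x} p i → Misses x (pair p) →
      pairColour p ≡ vertexColour i → ¬ CliqueNeighbour x i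
    shared-colour⇒nonadjacent p i misses shared xi with shared-colour⇒end p i shared
    ... | inj₁ refl = misses (inj₁ xi)
    ... | inj₂ refl = misses (inj₂ xi)

    independent : ∀ {c x y} → Class c x → Class c y → ¬ Adj G x y
    independent (member i refl refl) (member j refl ij) =
      Adj-irrefl G (cong f (vertexColour-inj (≡-sym ij)))
    independent (member i refl refl) (outside p misses pi) =
      shared-colour⇒nonadjacent p i misses pi ∘ Adj-sym G
    independent (outside p misses pi) (member i refl refl) =
      shared-colour⇒nonadjacent p i misses pi
    independent (outside p x-misses refl) (outside r y-misses rp)
      with refl ← pairColour-inj rp =
      missing-pair-independent 2K₂-free (ends-distinct p) x-misses y-misses

all-pairs-of-four : PairColouring 4 6
all-pairs-of-four = record
  { pair                 = pair
  ; ends-distinct        = toWitness {a? = all? λ p → ¬? (proj₁ (pair p) ≟ proj₂ (pair p))} tt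
  ; transversal-number≥3 = transversal-number≥3
  ; vertexColour         = _↑ˡ 2
  ; vertexColour-inj     = ↑ˡ-injective 2 _ _
  ; pairColour           = id
  ; pairColour-inj       = id
  ; shared-colour⇒end    = toWitness {a? = all? λ p → all? λ i →
      (p ≟ i ↑ˡ 2) →-dec meets? (i ≟_) (pair p)} tt
  }
  where
  pair : Fin 6 → Fin 4 × Fin 4
  pair = (0F , 1F) ∷ (1F , 2F) ∷ (2F , 3F) ∷ (0F , 3F) ∷ (0F , 2F) ∷ (1F , 3F) ∷ []

  -- One end each of {0,1} and {2,3}, and a third from the pair of the other two ends.
  transversal-number≥3 : TransversalNumber≥3 pair
  transversal-number≥3 meets with meets 0F | meets 2F
  ... | inj₁ s₀ | inj₁ s₂ = [ (λ s₁ → three s₀ s₁ s₂) , (λ s₃ → three s₀ s₂ s₃) ]′ (meets 5F)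
  ... | inj₁ s₀ | inj₂ s₃ = [ (λ s₁ → three s₀ s₁ s₃) , (λ s₂ → three s₀ s₂ s₃) ]′ (meets 1F)
  ... | inj₂ s₁ | inj₁ s₂ = [ (λ s₀ → three s₀ s₁ s₂) , (λ s₃ → three s₁ s₂ s₃) ]′ (meets 3F)
  ... | inj₂ s₁ | inj₂ s₃ = [ (λ s₀ → three s₀ s₁ s₃) , (λ s₂ → three s₁ s₂ s₃) ]′ (meets 4F)

triangle-and-edge : ∀ {k} → PairColouring (5 + k) (5 + k)
triangle-and-edge {k} = record
  { pair                 = pair
  ; ends-distinct        = λ { 0F () ; 1F () ; 2F () ; 3F () }
  ; transversal-number≥3 = transversal-number≥3
  ; vertexColour         = id
  ; vertexColour-inj     = id
  ; pairColour           = _↑ˡ suc k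
  ; pairColour-inj       = ↑ˡ-injective (suc k) _ _
  ; shared-colour⇒end    = λ where
      0F _ refl → inj₁ refl
      1F _ refl → inj₁ refl
      2F _ refl → inj₂ refl
      3F _ refl → inj₁ refl
  }
  where
  pair : Fin 4 → Fin (5 + k) × Fin (5 + k)
  pair = (0F , 1F) ∷ (1F , 2F) ∷ (0F , 2F) ∷ (3F , 4F) ∷ []

  transversal-number≥3 : TransversalNumber≥3 pair
  transversal-number≥3 meets with meets 0F | meets 1F | meets 2F
  ... | inj₁ s₀ | inj₁ s₁ | _       = [ three s₀ s₁ , three s₀ s₁ ]′ (meets 3F)
  ... | inj₁ s₀ | inj₂ s₂ | _       = [ three s₀ s₂ , three s₀ s₂ ]′ (meets 3F)
  ... | inj₂ s₁ | _       | inj₁ s₀ = [ three s₀ s₁ , three s₀ s₁ ]′ (meets 3F)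
  ... | inj₂ s₁ | _       | inj₂ s₂ = [ three s₁ s₂ , three s₁ s₂ ]′ (meets 3F)

theorem2p8 : (G : Graph) → (k : ℕ) → CliqueNumber G k → 4 ≤ k
    → Free 2K₂ G → Free K₅-e G
    → (k ≡ 4 → Colorable G 6) × (5 ≤ k → Colorable G k)
theorem2p8 G k (K , maximum) _ 2K₂-free K₅-e-free =
  (λ { refl → colorable all-pairs-of-four }) ,
  (λ { (s≤s (s≤s (s≤s (s≤s (s≤s _))))) → colorable triangle-and-edge })
  where
  colorable : ∀ {m} → PairColouring k m → Colorable G m
  colorable = pair-colouring⇒colorable G K maximum 2K₂-free K₅-e-free
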